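{- Let $x,y,z$ be pairwise distinct variables. The formula $\mathrm{dep}(x,y)\lor\mathrm{dep}(x,z)$ has coherence-level $4$.
   Context: A team $T$ with domain $X$ (a finite set of variables) and range $A$ is a set of assignments $s\colon X\to A$. $T\models\mathrm{dep}(v,w)$ iff for all $s_1,s_2\in T$ with $s_1(v)=s_2(v)$ we have $s_1(w)=s_2(w)$. $T\models\varphi_1\lor\varphi_2$ iff there are teams $T_1,T_2$ with $T=T_1\cup T_2$, $T_1\models\varphi_1$ and $T_2\models\varphi_2$. For $k\in\mathbb N$, $\varphi$ is $k$-coherent if for every team $T$ whose domain contains the variables of $\varphi$: $T\models\varphi$ iff every sub-team $S\subseteq T$ with at most $k$ elements satisfies $S\models\varphi$. The coherence-level of $\varphi$ is the least $k\in\mathbb N$ such that $\varphi$ is $k$-coherent. -}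

module Defs where

open import Level using (Level; Lift) renaming (suc to lsuc)
open import Data.List using (List; []; _∷_; _++_; length)
open import Data.List.Membership.Propositional using () renaming (_∈_ to _∈ₗ_)
open import Data.List.Membership.Propositional.Properties using (∈-++⁺ˡ; ∈-++⁺ʳ)
open import Data.List.Relation.Binary.Subset.Propositional using () renaming (_⊆_ to _⊆ₗ_)
open import Data.List.Relation.Unary.All as All using (All)
open import Data.List.Relation.Unary.Any using (here; there)
open import Data.List.Relation.Unary.Unique.Propositional using (Unique)
open import Data.Nat using (ℕ; _≤_)
open import Data.Product using (_×_; ∃-syntax)
open import Function using (_∘_)
open import Function.Bundles using (_⇔_)
open import Relation.Binary.PropositionalEquality using (_≡_; refl)
open import Relation.Unary using (Pred; _∈_; _⊆_; _∪_; _≐_)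

infixr 6 _∨_

data Formula (Var : Set) : Set where
  dep : (v w : Var) → Formula Var
  _∨_ : (φ₁ φ₂ : Formula Var) → Formula Var

vars : {Var : Set} → Formula Var → List Var
vars (dep v w) = v ∷ w ∷ []
vars (φ₁ ∨ φ₂) = vars φ₁ ++ vars φ₂

record Domain (Var : Set) : Set where
  constructor mkDomain
  field
    names    : List Var
    distinct : Unique names

open Domain public

-- An assignment is the tuple of its values, one for each name in the domain,
-- so that _≡_ on assignments is extensional without function extensionality.
Assignment : {Var : Set} {ℓ : Level} → Domain Var → Set ℓ → Set ℓ
Assignment X A = All (λ _ → A) (names X)

-- As the names are distinct, the value does not depend on the membership proof.
value : {Var : Set} {ℓ : Level} {X : Domain Var} {A : Set ℓ} →
        Assignment X A → {v : Var} → v ∈ₗ names X → A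
value s v∈X = All.lookup s v∈X

Team : {Var : Set} {ℓ : Level} → Domain Var → Set ℓ → Set (lsuc ℓ)
Team {ℓ = ℓ} X A = Pred (Assignment X A) ℓ

-- Satisfaction is defined only for teams whose domain contains vars φ.
-- Lift only adjusts the universe: the second clause quantifies over teams.
Satisfies : {Var : Set} {ℓ : Level} {X : Domain Var} {A : Set ℓ} →
            Team X A → (φ : Formula Var) → vars φ ⊆ₗ names X → Set (lsuc ℓ)
Satisfies {ℓ = ℓ} {X} {A} T (dep v w) vars⊆X = Lift (lsuc ℓ)
  ((s₁ s₂ : Assignment X A) → s₁ ∈ T → s₂ ∈ T →
   value {X = X} s₁ v∈X ≡ value {X = X} s₂ v∈X →
   value {X = X} s₁ w∈X ≡ value {X = X} s₂ w∈X)
  where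
  v∈X : v ∈ₗ names X
  v∈X = vars⊆X (here refl)
  w∈X : w ∈ₗ names X
  w∈X = vars⊆X (there (here refl))
Satisfies {X = X} {A} T (φ₁ ∨ φ₂) vars⊆X =
  ∃[ T₁ ] ∃[ T₂ ] T ≐ (T₁ ∪ T₂)
                × Satisfies {X = X} {A} T₁ φ₁ (vars⊆X ∘ ∈-++⁺ˡ)
                × Satisfies {X = X} {A} T₂ φ₂ (vars⊆X ∘ ∈-++⁺ʳ (vars φ₁))

-- The list enumerating the team may contain repetitions and further assignments.
AtMost : {Var : Set} {ℓ : Level} {X : Domain Var} {A : Set ℓ} → ℕ → Team X A → Set ℓ
AtMost {X = X} {A} k S =
  ∃[ ss ] length ss ≤ k × ((s : Assignment X A) → s ∈ S → s ∈ₗ ss)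

-- Teams range over a fixed but arbitrary universe level ℓ.
Coherent : {Var : Set} (ℓ : Level) → ℕ → Formula Var → Set (lsuc ℓ)
Coherent {Var} ℓ k φ =
  (X : Domain Var) (A : Set ℓ) (T : Team X A) (vars⊆X : vars φ ⊆ₗ names X) →
  Satisfies {X = X} T φ vars⊆X ⇔
  ((S : Team X A) → S ⊆ T → AtMost {X = X} k S → Satisfies {X = X} S φ vars⊆X)

HasCoherenceLevel : {Var : Set} (ℓ : Level) → Formula Var → ℕ → Set (lsuc ℓ)
HasCoherenceLevel ℓ φ k = Coherent ℓ k φ × ((j : ℕ) → Coherent ℓ j φ → k ≤ j)

{-# OPTIONS --safe #-}
-- A team satisfies dep(x,y) ∨ dep(x,z) iff each of its fibres over a value of x
-- is covered by a line y = b together with a line z = c.  If a fibre has no such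
-- cover, pick p₁ in it, then p₂ differing from p₁ in both y and z.  Two points
-- that differ in both coordinates can only be covered by (y p₁, z p₂) or by
-- (y p₂, z p₁); points p₃ and p₄ missed by these two candidates complete a
-- subteam of four elements that does not satisfy the formula.
-- For the lower bound, take the square {0,1}² as the only fibre: it has no cover,
-- but once a corner (b,c) is removed the lines y = 1-b and z = 1-c cover the rest.
module Submission where

open import Defs
open import Axiom.ExcludedMiddle using (ExcludedMiddle)
open import Data.Bool using (Bool; true; false; not)
open import Data.Bool.Properties using (¬-not) renaming (_≟_ to _≟ᵇ_)
open import Data.Fin using (Fin)
open import Data.Fin.Properties using (injective⇒≤; ¬∀⟶∃¬; *↔×; 2↔Bool)
open import Data.List using (List; []; _∷_; length)
open import Data.List.Membership.Propositional using () renaming (_∈_ to _∈ₗ_)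
open import Data.List.Membership.Propositional.Properties.WithK using (unique⇒irrelevant)
open import Data.List.Membership.Setoid.Properties using (index-injective)
open import Data.List.Relation.Binary.Subset.Propositional using () renaming (_⊆_ to _⊆ₗ_)
open import Data.List.Relation.Unary.All using ([]; _∷_)
open import Data.List.Relation.Unary.AllPairs using ([]; _∷_)
open import Data.List.Relation.Unary.Any using (here; there; index)
open import Data.Nat using (ℕ; _≤_; _≤?_)
open import Data.Nat.Properties using (≤-refl; ≤-trans)
open import Data.Product using (_×_; _,_; proj₁; proj₂; ∃-syntax)
open import Data.Product.Function.NonDependent.Propositional using (_×-↔_)
open import Data.Sum as Sum using (_⊎_; inj₁; inj₂; [_,_])
open import Function using (_∘_; id; const)
open import Function.Bundles using (_⇔_; mk⇔; _↔_; Injection; Inverse; Equivalence)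
open import Function.Construct.Composition using (_↔-∘_)
open import Function.Definitions using (Injective)
open import Function.Properties.Inverse using (↔⇒↣)
open import Level using (Level; Lift; lift) renaming (suc to lsuc)
open import Relation.Binary.PropositionalEquality
  using (_≡_; _≢_; refl; sym; trans; cong; setoid)
open import Relation.Nullary using (¬_; yes; no; contradiction)
open import Relation.Unary using (Pred; _∈_; _∉_; _⊆_; _∪_; _∩_; _≐_)

private
  variable
    ℓ : Level
    P : Set ℓ
    n : ℕ

-- Pigeonhole on positions: distinct points have distinct indices in `ps`, so repetitions in the
-- list do no harm.
injective⇒≤length : {p : Fin n → P} {ps : List P} → Injective _≡_ _≡_ p →
                    (∀ i → p i ∈ₗ ps) → n ≤ length ps
injective⇒≤length p-inj p∈ps =
  injective⇒≤ {f = λ i → index (p∈ps i)}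
    (λ {i} {j} eq → p-inj (index-injective (setoid _) (p∈ps i) (p∈ps j) eq))

module _ {P A : Set ℓ} where

  Determines : (P → A) → (P → A) → Pred P ℓ → Set ℓ
  Determines f g T = ∀ p q → p ∈ T → q ∈ T → f p ≡ f q → g p ≡ g q

  -- The semantics of the formula, with `f`, `g`, `h` in place of reading off x, y, z. This keeps
  -- domains and membership proofs out of the combinatorics.
  Splits : (f g h : P → A) → Pred P ℓ → Set (lsuc ℓ)
  Splits f g h T =
    ∃[ T₁ ] ∃[ T₂ ] T ≐ (T₁ ∪ T₂) × Determines f g T₁ × Determines f h T₂

  module _ {f g h : P → A} where

    Splits-⊆ : {S T : Pred P ℓ} → S ⊆ T → Splits f g h T → Splits f g h S
    Splits-⊆ {S} S⊆T (T₁ , T₂ , (T⊆ , _) , det₁ , det₂) =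
      S ∩ T₁ , S ∩ T₂ ,
      ((λ p∈S → Sum.map (p∈S ,_) (p∈S ,_) (T⊆ (S⊆T p∈S))) , [ proj₁ , proj₁ ]) ,
      (λ p q (_ , p∈T₁) (_ , q∈T₁) → det₁ p q p∈T₁ q∈T₁) ,
      (λ p q (_ , p∈T₂) (_ , q∈T₂) → det₂ p q p∈T₂ q∈T₂)

    -- The pieces are the points satisfying the first and the second alternative; they may overlap.
    -- On each piece `g` or `h` is a function of `f`.
    cover⇒Splits : {T : Pred P ℓ} (b c : A → A) →
                   (∀ p → p ∈ T → g p ≡ b (f p) ⊎ h p ≡ c (f p)) → Splits f g h T
    cover⇒Splits {T} b c cover =
      (λ p → p ∈ T × g p ≡ b (f p)) , (λ p → p ∈ T × h p ≡ c (f p)) ,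
      ((λ {p} p∈T → Sum.map (p∈T ,_) (p∈T ,_) (cover p p∈T)) , [ proj₁ , proj₁ ]) ,
      (λ p q (_ , gp) (_ , gq) eq → trans gp (trans (cong b eq) (sym gq))) ,
      (λ p q (_ , hp) (_ , hq) eq → trans hp (trans (cong c eq) (sym hq)))

    -- No piece contains both `p₁` and `p₂`. The point `p₃` rules out one way of separating them and
    -- `p₄` the other; `p₃` and `p₄` may coincide.
    crossing⇒¬Splits :
      {T : Pred P ℓ} {a : A} {p₁ p₂ p₃ p₄ : P} →
      p₁ ∈ T → p₂ ∈ T → p₃ ∈ T → p₄ ∈ T →
      f p₁ ≡ a → f p₂ ≡ a → f p₃ ≡ a → f p₄ ≡ a →
      g p₂ ≢ g p₁ → h p₂ ≢ h p₁ →
      g p₃ ≢ g p₁ → h p₃ ≢ h p₂ →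
      g p₄ ≢ g p₂ → h p₄ ≢ h p₁ →
      ¬ Splits f g h T
    crossing⇒¬Splits p₁∈T p₂∈T p₃∈T p₄∈T f₁ f₂ f₃ f₄ g₂₁ h₂₁ g₃₁ h₃₂ g₄₂ h₄₁
      (T₁ , T₂ , (T⊆ , _) , det₁ , det₂)
      with T⊆ p₁∈T | T⊆ p₂∈T
    ... | inj₁ in₁ | inj₁ in₂ = g₂₁ (det₁ _ _ in₂ in₁ (trans f₂ (sym f₁)))
    ... | inj₂ in₁ | inj₂ in₂ = h₂₁ (det₂ _ _ in₂ in₁ (trans f₂ (sym f₁)))
    ... | inj₁ in₁ | inj₂ in₂ =
      [ (λ in₃ → g₃₁ (det₁ _ _ in₃ in₁ (trans f₃ (sym f₁))))
      , (λ in₃ → h₃₂ (det₂ _ _ in₃ in₂ (trans f₃ (sym f₂)))) ] (T⊆ p₃∈T)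
    ... | inj₂ in₁ | inj₁ in₂ =
      [ (λ in₄ → g₄₂ (det₁ _ _ in₄ in₂ (trans f₄ (sym f₂))))
      , (λ in₄ → h₄₁ (det₂ _ _ in₄ in₁ (trans f₄ (sym f₁)))) ] (T⊆ p₄∈T)

    module _ (em : ExcludedMiddle ℓ) {T : Pred P ℓ} where

      Covers : (a b c : A) → Set ℓ
      Covers a b c = ∀ p → p ∈ T → f p ≡ a → g p ≡ b ⊎ h p ≡ c

      Misses : (a b c : A) → Set ℓ
      Misses a b c = ∃[ p ] p ∈ T × f p ≡ a × g p ≢ b × h p ≢ c

      covers⊎misses : ∀ a b c → Covers a b c ⊎ Misses a b c
      covers⊎misses a b c with em {Misses a b c}
      ... | yes missed = inj₂ missed
      ... | no ¬missed = inj₁ covers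
        where
        covers : Covers a b c
        covers p p∈T fp≡a with em {g p ≡ b} | em {h p ≡ c}
        ... | yes gp≡b | _        = inj₁ gp≡b
        ... | no _     | yes hp≡c = inj₂ hp≡c
        ... | no gp≢b  | no hp≢c  = contradiction (p , p∈T , fp≡a , gp≢b , hp≢c) ¬missed

      -- Excluded middle decides data, not just propositions, so the cover of each
      -- fibre is obtained as a function of a and no axiom of choice is needed.
      fibre-cover :
        (∀ ps → length ps ≤ 4 → (_∈ₗ ps) ⊆ T → Splits f g h (_∈ₗ ps)) →
        ∀ a → ∃[ b ] ∃[ c ] Covers a b c
      -- The fibre may be empty, so `a` itself, the only element of `A` at hand, serves as default
      -- value for both lines. If these lines fail, the point they miss is `p₁`.
      fibre-cover small a with covers⊎misses a a a
      ... | inj₁ covers = a , a , covers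
      ... | inj₂ (p₁ , p₁∈T , f₁ , _) with covers⊎misses a (g p₁) (h p₁)
      ... | inj₁ covers = _ , _ , covers
      ... | inj₂ (p₂ , p₂∈T , f₂ , g₂₁ , h₂₁)
            with covers⊎misses a (g p₁) (h p₂) | covers⊎misses a (g p₂) (h p₁)
      ... | inj₁ covers | _ = _ , _ , covers
      ... | inj₂ _ | inj₁ covers = _ , _ , covers
      ... | inj₂ (p₃ , p₃∈T , f₃ , g₃₁ , h₃₂) | inj₂ (p₄ , p₄∈T , f₄ , g₄₂ , h₄₁) =
        contradiction
          (small (p₁ ∷ p₂ ∷ p₃ ∷ p₄ ∷ []) ≤-refl λ where
            (here refl)                         → p₁∈T
            (there (here refl))                 → p₂∈T
            (there (there (here refl)))         → p₃∈T
            (there (there (there (here refl)))) → p₄∈T)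
          (crossing⇒¬Splits
            (here refl) (there (here refl)) (there (there (here refl)))
            (there (there (there (here refl))))
            f₁ f₂ f₃ f₄ g₂₁ h₂₁ g₃₁ h₃₂ g₄₂ h₄₁)

      -- Both dependencies compare only points with equal `f`, so covers found separately for each
      -- fibre combine into one splitting.
      Splits-from-4 :
        (∀ ps → length ps ≤ 4 → (_∈ₗ ps) ⊆ T → Splits f g h (_∈ₗ ps)) → Splits f g h T
      Splits-from-4 small =
        cover⇒Splits (proj₁ ∘ cover) (proj₁ ∘ proj₂ ∘ cover)
          (λ p p∈T → proj₂ (proj₂ (cover (f p))) p p∈T refl)
        where
        cover : ∀ a → ∃[ b ] ∃[ c ] Covers a b c
        cover = fibre-cover small

module Split-Semantics {Var : Set} (x y z : Var) (X : Domain Var) (A : Set ℓ)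
         (vars⊆X : vars (dep x y ∨ dep x z) ⊆ₗ names X) where

  x-value y-value z-value : Assignment X A → A
  x-value s = value {X = X} s (vars⊆X (here refl))
  y-value s = value {X = X} s (vars⊆X (there (here refl)))
  z-value s = value {X = X} s (vars⊆X (there (there (there (here refl)))))

  -- The variable `x` occurs in both disjuncts, and `vars⊆X` may locate its occurrences by different
  -- membership proofs. These proofs agree because the names of a domain are distinct.
  x-value-irrelevant : ∀ s → x-value s ≡ value {X = X} s (vars⊆X (there (there (here refl))))
  x-value-irrelevant s = cong (value {X = X} s) (unique⇒irrelevant (distinct X) _ _)

  Satisfies⇔Splits : (T : Team X A) →
    Satisfies {X = X} T (dep x y ∨ dep x z) vars⊆X ⇔ Splits x-value y-value z-value T
  Satisfies⇔Splits T = mk⇔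
    (λ (T₁ , T₂ , T≐ , lift det₁ , lift det₂) → T₁ , T₂ , T≐ , det₁ ,
      λ s t s∈T₂ t∈T₂ eq → det₂ s t s∈T₂ t∈T₂
        (trans (sym (x-value-irrelevant s)) (trans eq (x-value-irrelevant t))))
    (λ (T₁ , T₂ , T≐ , det₁ , det₂) → T₁ , T₂ , T≐ , lift det₁ ,
      lift λ s t s∈T₂ t∈T₂ eq → det₂ s t s∈T₂ t∈T₂
        (trans (x-value-irrelevant s) (trans eq (sym (x-value-irrelevant t)))))

  module _ (T : Team X A) where
    open Equivalence (Satisfies⇔Splits T) public
      renaming (to to Satisfies⇒Splits; from to Splits⇒Satisfies)

4-coherent : ExcludedMiddle ℓ → {Var : Set} {x y z : Var} → Coherent ℓ 4 (dep x y ∨ dep x z)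
4-coherent em {x = x} {y} {z} X A T vars⊆X = mk⇔ restrict λ small →
  Splits⇒Satisfies T (Splits-from-4 em
    λ ss ≤4 ss⊆T → Satisfies⇒Splits (_∈ₗ ss) (small (_∈ₗ ss) ss⊆T (ss , ≤4 , λ _ → id)))
  where
  open Split-Semantics x y z X A vars⊆X

  restrict : Satisfies {X = X} T (dep x y ∨ dep x z) vars⊆X → (S : Team X A) → S ⊆ T →
             AtMost {X = X} 4 S → Satisfies {X = X} S (dep x y ∨ dep x z) vars⊆X
  restrict sat S S⊆T _ =
    Splits⇒Satisfies S (Splits-⊆ {S = S} {T} S⊆T (Satisfies⇒Splits T sat))

module Square (ℓ : Level) {Var : Set} {x y z : Var}
              (x≢y : x ≢ y) (x≢z : x ≢ z) (y≢z : y ≢ z) where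

  A : Set ℓ
  A = Lift ℓ Bool

  X : Domain Var
  X = mkDomain (x ∷ y ∷ z ∷ []) ((x≢y ∷ x≢z ∷ []) ∷ (y≢z ∷ []) ∷ [] ∷ [])

  vars⊆X : vars (dep x y ∨ dep x z) ⊆ₗ names X
  vars⊆X (here eq)                         = here eq
  vars⊆X (there (here eq))                 = there (here eq)
  vars⊆X (there (there (here eq)))         = here eq
  vars⊆X (there (there (there (here eq)))) = there (there (here eq))

  open Split-Semantics x y z X A vars⊆X

  corner : Bool × Bool → Assignment X A
  corner (b , c) = lift false ∷ lift b ∷ lift c ∷ []

  corner-injective : Injective _≡_ _≡_ corner
  corner-injective refl = refl

  square : Team X A
  square s = ∃[ bc ] s ≡ corner bc

  square-¬satisfies : ¬ Satisfies {X = X} square (dep x y ∨ dep x z) vars⊆X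
  square-¬satisfies sat =
    crossing⇒¬Splits {T = square}
      -- A pair of opposite corners plays `p₁` and `p₂`; the other diagonal supplies `p₃` and `p₄`.
      ((false , false) , refl) ((true , true) , refl)
      ((true , false) , refl) ((false , true) , refl)
      refl refl refl refl (λ ()) (λ ()) (λ ()) (λ ()) (λ ()) (λ ())
      (Satisfies⇒Splits square sat)

  missing-corner⇒satisfies : {S : Team X A} → S ⊆ square →
    ∀ bc → corner bc ∉ S → Satisfies {X = X} S (dep x y ∨ dep x z) vars⊆X
  missing-corner⇒satisfies {S = S} S⊆square (b , c) corner∉S =
    Splits⇒Satisfies S
      -- The two lines meet in the corner opposite the missing one. Constant functions suffice, as
      -- the square lies in a single fibre.
      (cover⇒Splits {T = S} (const (lift (not b))) (const (lift (not c))) cover)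
    where
    cover : ∀ s → s ∈ S → y-value s ≡ lift (not b) ⊎ z-value s ≡ lift (not c)
    cover s s∈S with S⊆square s∈S
    ... | (b′ , c′) , refl with b′ ≟ᵇ b | c′ ≟ᵇ c
    ... | no b′≢b  | _        = inj₁ (cong lift (¬-not b′≢b))
    ... | yes _    | no c′≢c  = inj₂ (cong lift (¬-not c′≢c))
    ... | yes refl | yes refl = contradiction s∈S corner∉S

  -- Indexing by `Fin 4` serves both the pigeonhole count and the finite search for a missing
  -- corner.
  corners : Fin 4 ↔ (Bool × Bool)
  corners = (2↔Bool ×-↔ 2↔Bool) ↔-∘ *↔× {2} {2}

  coherent⇒4≤ : ExcludedMiddle ℓ → ∀ j → Coherent ℓ j (dep x y ∨ dep x z) → 4 ≤ j
  coherent⇒4≤ em j coherent with 4 ≤? j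
  ... | yes 4≤j = 4≤j
  ... | no  4≰j = contradiction
    (Equivalence.from (coherent X A square vars⊆X) small) square-¬satisfies
    where
    p : Fin 4 → Assignment X A
    p = corner ∘ Inverse.to corners

    small : ∀ S → S ⊆ square → AtMost {X = X} j S →
            Satisfies {X = X} S (dep x y ∨ dep x z) vars⊆X
    small S S⊆square (ss , ss≤j , S⊆ss)
      -- If `S` contained all four corners, its enumerating list would have length at least 4.
      -- Excluded middle decides membership in `S`, so the search returns a specific missing corner.
      with i , pᵢ∉S ← ¬∀⟶∃¬ 4 (λ i → p i ∈ S) (λ _ → em) (λ p∈S → 4≰j (≤-trans
             (injective⇒≤length (Injection.injective (↔⇒↣ corners) ∘ corner-injective)
               (λ i → S⊆ss (p i) (p∈S i)))
             ss≤j))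
      = missing-corner⇒satisfies S⊆square (Inverse.to corners i) pᵢ∉S

theorem21 : {ℓ : Level} → ExcludedMiddle ℓ →
    {Var : Set} (x y z : Var) → x ≢ y → x ≢ z → y ≢ z →
    HasCoherenceLevel ℓ (dep x y ∨ dep x z) 4
theorem21 em x y z x≢y x≢z y≢z = 4-coherent em , Square.coherent⇒4≤ _ x≢y x≢z y≢z em
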